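{- Let $F:\mathbf{Sets}\to\mathbf{Sets}$ be a functor, $(\Omega,\sqsubseteq_\Omega)$ a truth-value domain and $\sigma:F\Omega\to\Omega$ an $F$-modality satisfying the standing assumptions (A1) and (A2). Let $(r:FR\to R,\ q:R\to\Omega,\ \sqsubseteq_R)$ be a ranking domain for $F$ and $\sigma$. Let $c:X\to FX$ be an $F$-coalgebra and let $b:X\to R$ be a ranking arrow for $c$, i.e. $b\sqsubseteq_R r\circ Fb\circ c$ (pointwise). Then $$q\circ b\ \sqsubseteq_\Omega\ \llbracket\mu\sigma\rrbracket_c$$ (pointwise), where $\llbracket\mu\sigma\rrbracket_c:X\to\Omega$ is the least fixed point of $f\mapsto \sigma\circ Ff\circ c$.
   Context: $\mathbf{Sets}$ is the category of sets and functions. For a functor $F:\mathbf{Sets}\to\mathbf{Sets}$, an $F$-coalgebra is a function $c:X\to FX$ and an $F$-algebra is a function $a:FA\to A$. For such $c,a$ define $\Phi_{c,a}:A^X\to A^X$ by $\Phi_{c,a}(f)=a\circ Ff\circ c$. Functions into a poset are ordered pointwise. An algebra $r:FR\to R$ is corecursive if for every coalgebra $c:X\to FX$ there is exactly one $f:X\to R$ with $f=r\circ Ff\circ c$. A truth-value domain is a poset $(\Omega,\sqsubseteq_\Omega)$; an $F$-modality over it is an $F$-algebra $\sigma:F\Omega\to\Omega$. Standing assumptions: (A1) $(\Omega,\sqsubseteq_\Omega)$ is a complete lattice; (A2) for each coalgebra $c:X\to FX$, $\Phi_{c,\sigma}:\Omega^X\to\Omega^X$ is monotone. Then $\Phi_{c,\sigma}$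 has a least fixed point, denoted $\llbracket\mu\sigma\rrbracket_c:X\to\Omega$. A ranking domain for $F$ and $\sigma$ is a triple $(r,q,\sqsubseteq_R)$ with $r:FR\to R$ an $F$-algebra, $q:R\to\Omega$ a function, and $\sqsubseteq_R$ a partial order on $R$, such that: (1) $q\circ r\sqsubseteq_\Omega\sigma\circ Fq$ pointwise on $FR$; (2) $(R,\sqsubseteq_R)$ is a complete lattice, and for each $c:X\to FX$ the function $\Phi_{c,r}:R^X\to R^X$ is monotone; (3) $q$ is monotone, strict ($q(\bot_R)=\bot_\Omega$) and continuous ($q(\bigsqcup_{a\in K}a)=\bigsqcup_{a\in K}q(a)$ for each subset $K\subseteq R$); (4) $r$ is corecursive. -}

module Defs where

open import Data.Product using (∃; ∃-syntax; ∃!; _×_; _,_)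
open import Function using (_∘_; id)
open import Level using (Level; suc)
open import Relation.Binary using (Rel; IsPartialOrder; Minimum; Monotonic₁)
open import Relation.Binary.PropositionalEquality using (_≡_; _≗_; refl; sym)
open import Relation.Unary using (Pred; _∈_)
open import Relation.Unary.Polymorphic using (∅)

-- Sets is the category of types in Set ℓ.  There is no function
-- extensionality, so equality of morphisms is pointwise equality _≗_, and a
-- functor has to respect it (F-resp-≗).
record Functor (ℓ : Level) : Set (suc ℓ) where
  field
    F₀           : Set ℓ → Set ℓ
    F₁           : {A B : Set ℓ} → (A → B) → F₀ A → F₀ B
    F-resp-≗     : {A B : Set ℓ} {f g : A → B} → f ≗ g → F₁ f ≗ F₁ g
    identity     : {A : Set ℓ} → F₁ (id {A = A}) ≗ id
    homomorphism : {A B C : Set ℓ} (g : B → C) (f : A → B) →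
                   F₁ (g ∘ f) ≗ F₁ g ∘ F₁ f

module _ {ℓ : Level} where

  Pointwise : {A : Set ℓ} → Rel A ℓ → (X : Set ℓ) → Rel (X → A) ℓ
  Pointwise _⊑_ X f g = ∀ x → f x ⊑ g x

  module _ {A : Set ℓ} (_⊑_ : Rel A ℓ) where

    IsSupremum : Pred A ℓ → A → Set ℓ
    IsSupremum K s =
      (∀ {a} → a ∈ K → a ⊑ s) × (∀ {u} → (∀ {a} → a ∈ K → a ⊑ u) → s ⊑ u)

    IsInfimum : Pred A ℓ → A → Set ℓ
    IsInfimum K i =
      (∀ {a} → a ∈ K → i ⊑ a) × (∀ {l} → (∀ {a} → a ∈ K → l ⊑ a) → l ⊑ i)

    record IsCompleteLattice : Set (suc ℓ) where
      field
        isPartialOrder : IsPartialOrder _≡_ _⊑_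
        ⨆              : Pred A ℓ → A
        ⨆-isSupremum   : ∀ K → IsSupremum K (⨆ K)
        ⨅              : Pred A ℓ → A
        ⨅-isInfimum    : ∀ K → IsInfimum K (⨅ K)

      open IsPartialOrder isPartialOrder public
        using (antisym) renaming (refl to ⊑-refl; trans to ⊑-trans)

      ⊥ : A
      ⊥ = ⨆ ∅

      ⊥-minimum : Minimum _⊑_ ⊥
      ⊥-minimum a = let (_ , least) = ⨆-isSupremum ∅ in least λ ()

    IsLeastFixedPoint : {X : Set ℓ} → ((X → A) → (X → A)) → (X → A) → Set ℓ
    IsLeastFixedPoint {X} Φ l =
      l ≗ Φ l × (∀ f → f ≗ Φ f → Pointwise _⊑_ X l f)

  image : {A B : Set ℓ} → (A → B) → Pred A ℓ → Pred B ℓ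
  image q K y = ∃[ x ] x ∈ K × q x ≡ y

  -- Knaster–Tarski on X → A.  With the pointwise order X → A is complete only
  -- up to _≗_, so the infimum of the pre-fixed points is taken pointwise.
  module _ {A : Set ℓ} {_⊑_ : Rel A ℓ} (complete : IsCompleteLattice _⊑_) where
    open IsCompleteLattice complete

    leastFixedPoint : {X : Set ℓ} (Φ : (X → A) → (X → A)) →
                      Monotonic₁ (Pointwise _⊑_ X) (Pointwise _⊑_ X) Φ →
                      ∃ (IsLeastFixedPoint _⊑_ Φ)
    leastFixedPoint {X} Φ mono =
      l , (λ x → antisym (postfixed x) (prefixed x)) ,
      λ f f≗Φf → lower f λ x → reflexive (sym (f≗Φf x))
      where
      open IsPartialOrder isPartialOrder using (reflexive)

      PreFixedPointValues : X → Pred A ℓ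
      PreFixedPointValues x a = ∃[ f ] Pointwise _⊑_ X (Φ f) f × f x ≡ a

      l : X → A
      l x = ⨅ (PreFixedPointValues x)

      lower : ∀ f → Pointwise _⊑_ X (Φ f) f → Pointwise _⊑_ X l f
      lower f Φf⊑f x =
        let (below , _) = ⨅-isInfimum (PreFixedPointValues x)
        in below (f , Φf⊑f , refl)

      prefixed : Pointwise _⊑_ X (Φ l) l
      prefixed x =
        let (_ , greatest) = ⨅-isInfimum (PreFixedPointValues x)
        in greatest λ { (f , Φf⊑f , refl) →
             ⊑-trans (mono (lower f Φf⊑f) x) (Φf⊑f x) }

      postfixed : Pointwise _⊑_ X l (Φ l)
      postfixed = lower (Φ l) (mono prefixed)

module _ {ℓ : Level} (F : Functor ℓ) where
  open Functor F

  Coalgebra : Set ℓ → Set ℓ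
  Coalgebra X = X → F₀ X

  Algebra : Set ℓ → Set ℓ
  Algebra A = F₀ A → A

  Φ : {X A : Set ℓ} → Coalgebra X → Algebra A → (X → A) → (X → A)
  Φ c a f = a ∘ F₁ f ∘ c

  IsCorecursive : {R : Set ℓ} → Algebra R → Set (suc ℓ)
  IsCorecursive {R} r =
    {X : Set ℓ} (c : Coalgebra X) → ∃! _≗_ λ (f : X → R) → f ≗ Φ c r f

  Φ-Monotone : {A : Set ℓ} → Rel A ℓ → Algebra A → Set (suc ℓ)
  Φ-Monotone _⊑_ a = {X : Set ℓ} (c : Coalgebra X) →
    Monotonic₁ (Pointwise _⊑_ X) (Pointwise _⊑_ X) (Φ c a)

  module _ {Ω : Set ℓ} {_⊑_ : Rel Ω ℓ} (Ω-complete : IsCompleteLattice _⊑_)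
           (σ : Algebra Ω) (σ-monotone : Φ-Monotone _⊑_ σ)
           {X : Set ℓ} (c : Coalgebra X) where

    ⟦μ⟧-exists : ∃ (IsLeastFixedPoint _⊑_ (Φ c σ))
    ⟦μ⟧-exists = leastFixedPoint Ω-complete (Φ c σ) (σ-monotone c)

    ⟦μ⟧ : X → Ω
    ⟦μ⟧ = let (l , _) = ⟦μ⟧-exists in l

  record RankingDomain {Ω : Set ℓ} {_⊑_ : Rel Ω ℓ}
                       (Ω-complete : IsCompleteLattice _⊑_)
                       (σ : Algebra Ω) : Set (suc ℓ) where
    private module Ω = IsCompleteLattice Ω-complete

    field
      R          : Set ℓ
      r          : Algebra R
      q          : R → Ω
      _⊑ᴿ_       : Rel R ℓ
      q∘r⊑σ∘Fq   : Pointwise _⊑_ (F₀ R) (q ∘ r) (σ ∘ F₁ q)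
      R-complete : IsCompleteLattice _⊑ᴿ_

    private module R = IsCompleteLattice R-complete

    field
      Φ-monotone   : Φ-Monotone _⊑ᴿ_ r
      q-monotone   : Monotonic₁ _⊑ᴿ_ _⊑_ q
      q-strict     : q R.⊥ ≡ Ω.⊥
      q-continuous : (K : Pred R ℓ) → q (R.⨆ K) ≡ Ω.⨆ (image q K)
      corecursive  : IsCorecursive r

    IsRankingArrow : {X : Set ℓ} → Coalgebra X → (X → R) → Set ℓ
    IsRankingArrow {X} c b = Pointwise _⊑ᴿ_ X b (Φ c r b)

{-# OPTIONS --safe #-}

-- Corecursiveness makes the fixed point of Φ c r unique, so every post-fixed
-- point of it lies below every pre-fixed point (Knaster–Tarski from both
-- sides).  The ranking arrow b is post-fixed, and
-- x ↦ ⨆ { a ∣ q a ⊑ ⟦μσ⟧ x } is pre-fixed; continuity of q bounds its image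
-- under q by ⟦μσ⟧.  No transfinite iteration from ⊥ is
-- needed.
module Submission where

open import Defs
open import Data.Product using (∃-syntax; _×_; _,_; proj₁; proj₂)
open import Level using (Level)
open import Function using (_∘_; flip)
open import Relation.Binary using (Rel; IsPartialOrder; Monotonic₁)
import Relation.Binary.Construct.Flip.EqAndOrd as Flip
open import Relation.Binary.PropositionalEquality using (_≡_; _≗_; refl; sym; trans; cong)
open import Relation.Unary using (Pred)

private
  variable
    ℓ : Level

flip-isCompleteLattice : {A : Set ℓ} {_⊑_ : Rel A ℓ} →
                         IsCompleteLattice _⊑_ → IsCompleteLattice (flip _⊑_)
flip-isCompleteLattice complete = record
  { isPartialOrder = Flip.isPartialOrder isPartialOrder
  ; ⨆              = ⨅
  ; ⨆-isSupremum   = ⨅-isInfimum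
  ; ⨅              = ⨆
  ; ⨅-isInfimum    = ⨆-isSupremum
  }
  where open IsCompleteLattice complete

-- The fixed point of Defs.leastFixedPoint is only known to be below fixed
-- points, not below pre-fixed ones.
fixedPointBelow :
  {A : Set ℓ} {_⊑_ : Rel A ℓ} → IsCompleteLattice _⊑_ →
  {X : Set ℓ} (Ψ : (X → A) → (X → A)) →
  Monotonic₁ (Pointwise _⊑_ X) (Pointwise _⊑_ X) Ψ →
  ∀ g → Pointwise _⊑_ X (Ψ g) g → ∃[ f ] f ≗ Ψ f × Pointwise _⊑_ X f g
fixedPointBelow {ℓ} {A} {_⊑_} complete {X} Ψ mono g Ψg⊑g =
  l , (λ x → antisym (postfixed x) (prefixed x)) , lower g Ψg⊑g
  where
  open IsCompleteLattice complete

  PreFixedPointValues : X → Pred A ℓ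
  PreFixedPointValues x a = ∃[ f ] Pointwise _⊑_ X (Ψ f) f × f x ≡ a

  l : X → A
  l x = ⨅ (PreFixedPointValues x)

  lower : ∀ f → Pointwise _⊑_ X (Ψ f) f → Pointwise _⊑_ X l f
  lower f Ψf⊑f x = proj₁ (⨅-isInfimum (PreFixedPointValues x)) (f , Ψf⊑f , refl)

  prefixed : Pointwise _⊑_ X (Ψ l) l
  prefixed x = proj₂ (⨅-isInfimum (PreFixedPointValues x))
    λ { (f , Ψf⊑f , refl) → ⊑-trans (mono (lower f Ψf⊑f) x) (Ψf⊑f x) }

  postfixed : Pointwise _⊑_ X l (Ψ l)
  postfixed = lower (Ψ l) (mono prefixed)

-- Reversing the order turns post-fixed points of `Ψ` into pre-fixed ones.
fixedPointAbove :
  {A : Set ℓ} {_⊑_ : Rel A ℓ} → IsCompleteLattice _⊑_ →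
  {X : Set ℓ} (Ψ : (X → A) → (X → A)) →
  Monotonic₁ (Pointwise _⊑_ X) (Pointwise _⊑_ X) Ψ →
  ∀ b → Pointwise _⊑_ X b (Ψ b) → ∃[ f ] f ≗ Ψ f × Pointwise _⊑_ X b f
fixedPointAbove complete Ψ mono =
  -- The eta-expansion lets the implicit endpoints of `mono` be inferred afresh, since the reversed
  -- order swaps them.
  fixedPointBelow (flip-isCompleteLattice complete) Ψ (λ f⊑g → mono f⊑g)

postfixed⊑prefixed :
  (F : Functor ℓ) {R : Set ℓ} {_⊑_ : Rel R ℓ} → IsCompleteLattice _⊑_ →
  (r : Algebra F R) → Φ-Monotone F _⊑_ r → IsCorecursive F r →
  {X : Set ℓ} (c : Coalgebra F X) {b g : X → R} →
  Pointwise _⊑_ X b (Φ F c r b) → Pointwise _⊑_ X (Φ F c r g) g →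
  Pointwise _⊑_ X b g
postfixed⊑prefixed F complete r mono corecursive c {b} {g} b⊑Φb Φg⊑g x =
  let (h , h-fixed , b⊑h) = fixedPointAbove complete (Φ F c r) (mono c) b b⊑Φb
      (k , k-fixed , k⊑g) = fixedPointBelow complete (Φ F c r) (mono c) g Φg⊑g
      (_ , _ , unique)    = corecursive c
      -- Both fixed points agree with the unique solution that corecursiveness provides, hence with
      -- each other.
      h≡k                 = trans (sym (unique h-fixed x)) (unique k-fixed x)
  in ⊑-trans (b⊑h x) (⊑-trans (reflexive h≡k) (k⊑g x))
  where
  open IsCompleteLattice complete
  open IsPartialOrder isPartialOrder using (reflexive)

mainTheorem1 : {ℓ : Level} (F : Functor ℓ)
    {Ω : Set ℓ} (_⊑_ : Rel Ω ℓ) (Ω-complete : IsCompleteLattice _⊑_)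
    (σ : Algebra F Ω) (σ-monotone : Φ-Monotone F _⊑_ σ)
    (D : RankingDomain F Ω-complete σ)
    {X : Set ℓ} (c : Coalgebra F X) (b : X → RankingDomain.R D) →
    RankingDomain.IsRankingArrow D c b →
    Pointwise _⊑_ X (RankingDomain.q D ∘ b) (⟦μ⟧ F Ω-complete σ σ-monotone c)
mainTheorem1 {ℓ} F {Ω} _⊑_ Ω-complete σ σ-monotone D {X} c b b⊑Φb x =
  Ω.⊑-trans (q-monotone (b⊑g x)) (q∘g⊑μ x)
  where
  open Functor F
  open RankingDomain D
  module Ω = IsCompleteLattice Ω-complete
  module R = IsCompleteLattice R-complete
  open IsPartialOrder Ω.isPartialOrder using (reflexive)

  μ : X → Ω
  μ = ⟦μ⟧ F Ω-complete σ σ-monotone c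

  μ-fixed : μ ≗ Φ F c σ μ
  μ-fixed = proj₁ (proj₂ (⟦μ⟧-exists F Ω-complete σ σ-monotone c))

  RanksBelow : X → Pred R ℓ
  RanksBelow y a = q a ⊑ μ y

  -- This is `μ` followed by the right adjoint of `q`, which exists because `q` preserves all joins.
  g : X → R
  g y = R.⨆ (RanksBelow y)

  q∘g⊑μ : Pointwise _⊑_ X (q ∘ g) μ
  q∘g⊑μ y = Ω.⊑-trans (reflexive (q-continuous (RanksBelow y)))
    (proj₂ (Ω.⨆-isSupremum (image q (RanksBelow y))) λ { (_ , qa⊑μy , refl) → qa⊑μy })

  q∘Φg⊑μ : Pointwise _⊑_ X (q ∘ Φ F c r g) μ
  q∘Φg⊑μ y =
    -- Move `q` past `r`, fuse `F₁ q` with `F₁ g` by functoriality, replace `q ∘ g` by `μ` using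
    -- monotonicity, then fold the fixed point.
    Ω.⊑-trans (q∘r⊑σ∘Fq (F₁ g (c y)))
    (Ω.⊑-trans (reflexive (cong σ (sym (homomorphism q g (c y)))))
    (Ω.⊑-trans (σ-monotone c q∘g⊑μ y)
    (reflexive (sym (μ-fixed y)))))

  Φg⊑g : Pointwise _⊑ᴿ_ X (Φ F c r g) g
  -- The bound `q∘Φg⊑μ y` is exactly membership in `RanksBelow y`, whose join is `g y`.
  Φg⊑g y = proj₁ (R.⨆-isSupremum (RanksBelow y)) (q∘Φg⊑μ y)

  b⊑g : Pointwise _⊑ᴿ_ X b g
  b⊑g = postfixed⊑prefixed F R-complete r Φ-monotone corecursive c b⊑Φb Φg⊑g
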